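{- Let $n\ge3$. For every automorphism $T\in\mathbb{T}_n^3$ there exists $A\in\mathbb{A}_n^3$ such that $T\circ A$ fixes every corner of the cube $n^3$ and fixes every point of the line $\ell=\{[i,0,0]: i\in[n]\}$.
   Context: Let $[n]=\{0,\dots,n-1\}$; the cube $n^3$ is $[n]^3$. A set of $n$ distinct points is a line if it can be ordered $(q^1,\dots,q^n)$ such that in each coordinate the sequence of values is strictly increasing, strictly decreasing or constant, with at least one coordinate non-constant. $\mathbb{T}_n^3$ is the group of permutations of $[n]^3$ mapping lines onto lines. Composition is written left to right: $(T\circ A)(p)=A(T(p))$. A corner is a point all of whose coordinates lie in $\{0,n-1\}$. $\mathbb{R}$ is the group generated by $R_x([x,y,z])=[x,n-z-1,y]$, $R_y([x,y,z])=[n-z-1,y,x]$, $R_z([x,y,z])=[n-y-1,x,z]$. $\mathbb{F}_n$ is the group of maps $F_\pi([x,y,z])=[\pi(x),\pi(y),\pi(z)]$ for permutations $\pi$ of $[n]$ with $\pi(n-p-1)=n-\pi(p)-1$ for all $p$. $\mathbb{A}_n^3$ is the group generated by $\mathbb{R}\cup\mathbb{F}_n$. -}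

module Defs where

open import Level using (0ℓ)
open import Data.Nat using (ℕ; _∸_)
open import Data.Fin using (Fin; toℕ; opposite; _<_)
open import Data.Product using (Σ; ∃; ∃-syntax; _×_; _,_)
open import Data.Sum using (_⊎_)
open import Relation.Nullary using (¬_)
open import Relation.Unary using (Pred)
open import Relation.Binary.PropositionalEquality using (_≡_)
open import Function.Bundles using (_↔_; Inverse; _⇔_)
open import Function.Definitions using (Injective)

Point : ℕ → Set
Point n = Fin n × Fin n × Fin n

module _ {n : ℕ} where

  xc yc zc : Point n → Fin n
  xc (x , y , z) = x
  yc (x , y , z) = y
  zc (x , y , z) = z

  StrictlyIncreasing StrictlyDecreasing Constant : (Fin n → Fin n) → Set
  StrictlyIncreasing f = ∀ i j → i < j → f i < f j
  StrictlyDecreasing f = ∀ i j → i < j → f j < f i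
  Constant f = ∀ i j → f i ≡ f j

  Monotone : (Fin n → Fin n) → Set
  Monotone f = StrictlyIncreasing f ⊎ StrictlyDecreasing f ⊎ Constant f

  IsLineOrdering : (Fin n → Point n) → Set
  IsLineOrdering q =
    Injective _≡_ _≡_ q
    × Monotone (λ i → xc (q i)) × Monotone (λ i → yc (q i)) × Monotone (λ i → zc (q i))
    × ¬ (Constant (λ i → xc (q i)) × Constant (λ i → yc (q i)) × Constant (λ i → zc (q i)))

  IsLine : Pred (Point n) 0ℓ → Set
  IsLine S = ∃[ q ] (IsLineOrdering q × (∀ p → S p ⇔ (∃[ i ] q i ≡ p)))

  Image : (Point n → Point n) → Pred (Point n) 0ℓ → Pred (Point n) 0ℓ
  Image f S p = ∃[ x ] (S x × f x ≡ p)

  record Automorphism : Set₁ where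
    field
      perm  : Point n ↔ Point n
      lines : ∀ S → IsLine S → IsLine (Image (Inverse.to perm) S)

  Rx Ry Rz Rx⁻¹ Ry⁻¹ Rz⁻¹ : Point n → Point n
  Rx (x , y , z) = (x , opposite z , y)
  Ry (x , y , z) = (opposite z , y , x)
  Rz (x , y , z) = (opposite y , x , z)
  Rx⁻¹ (x , y , z) = (x , z , opposite y)
  Ry⁻¹ (x , y , z) = (z , y , opposite x)
  Rz⁻¹ (x , y , z) = (y , opposite x , z)

  SymmetricPerm : (Fin n ↔ Fin n) → Set
  SymmetricPerm π = ∀ p → Inverse.to π (opposite p) ≡ opposite (Inverse.to π p)

  Fπ : (Fin n ↔ Fin n) → Point n → Point n
  Fπ π (x , y , z) = (Inverse.to π x , Inverse.to π y , Inverse.to π z)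

  -- membership in 𝔸_n^3 = ⟨ ℝ ∪ 𝔽_n ⟩ : finite products of generators and their
  -- inverses (𝔽_n is closed under inverses, since π⁻¹ is again symmetric)
  data InA : (Point n → Point n) → Set where
    idA   : InA (λ p → p)
    rx    : InA Rx
    ry    : InA Ry
    rz    : InA Rz
    rx⁻¹  : InA Rx⁻¹
    ry⁻¹  : InA Ry⁻¹
    rz⁻¹  : InA Rz⁻¹
    fπ    : (π : Fin n ↔ Fin n) → SymmetricPerm π → InA (Fπ π)
    _∙_   : ∀ {f g} → InA f → InA g → InA (λ p → g (f p))

  IsExtreme : Fin n → Set
  IsExtreme c = toℕ c ≡ 0 ⊎ toℕ c ≡ n ∸ 1

  IsCorner : Point n → Set
  IsCorner (x , y , z) = IsExtreme x × IsExtreme y × IsExtreme z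

  OnEll : Point n → Set
  OnEll (x , y , z) = toℕ y ≡ 0 × toℕ z ≡ 0

{-# OPTIONS --safe #-}
module Submission where

-- A strictly monotone self-map of [n] is the identity or the reversal t ↦ −t := n − 1 − t, so
-- the coordinates of a line are each constant, t or −t.  At least seven lines pass through
-- a point (±a, ±a, ±a) and at most five through any other point.  Hence T, whose inverse is a
-- power of T and so also maps lines to lines, preserves the set of points on main diagonals,
-- the set of main diagonals, and the partition of the former points into the cubes {a, −a}³.
-- Only the centre lies on several main diagonals, so T(000) is not the centre, and an element
-- of 𝔸 takes T(000) back to 000; now T permutes the corners and preserves antipodes.  Edges
-- cannot be exchanged with face diagonals, so after permuting the axes T fixes the three
-- neighbours of 000, and with their antipodes all corners.  Then T [t, 0, 0] = [τ t, 0, 0] for a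
-- permutation τ; comparing with T [t, t, t], which lies in the cube of τ t, shows that τ commutes
-- with the reversal, and F_π for π = τ⁻¹ finishes.

open import Defs
open import Data.Bool using (Bool; true; false; not)
open import Data.Bool.Properties using (¬-not; not-¬) renaming (_≟_ to _≟ᵇ_)
open import Data.Empty using (⊥; ⊥-elim)
open import Data.Fin using (Fin; zero; suc; toℕ; fromℕ<; opposite; combine; remQuot; funToFin; finToFun; _≟_) renaming (_<_ to _<ᶠ_)
open import Data.Fin.Properties using (toℕ-injective; toℕ-fromℕ<; toℕ-fromℕ; toℕ<n; opposite-prop; opposite-involutive; pigeonhole; finToFun-funToFin; remQuot-combine; <⇒≢)
open import Data.Nat as ℕ using (ℕ; zero; suc; _≤_; z≤n; s≤s)
import Data.Nat.Properties as ℕ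
open import Data.Product using (∃-syntax; _×_; _,_; proj₁; proj₂)
open import Data.Sum using (_⊎_; inj₁; inj₂)
open import Function using (_∘_; id)
open import Function.Bundles using (_↔_; Inverse; Equivalence; mk⇔; mk↔ₛ′)
open import Relation.Binary.PropositionalEquality using (_≡_; _≢_; _≗_; refl; sym; trans; cong; cong₂; subst; module ≡-Reasoning)
open import Relation.Binary using (tri<; tri≈; tri>)
open import Relation.Nullary using (¬_; Dec; yes; no; contradiction)

-- Strictly monotone self-maps of [n].

opposite-anti-< : ∀ {n} {i j : Fin n} → i <ᶠ j → opposite j <ᶠ opposite i
opposite-anti-< {n} {i} {j} i<j
  rewrite opposite-prop i | opposite-prop j = ℕ.∸-monoʳ-< (s≤s i<j) (toℕ<n j)

opposite-fixed-unique : ∀ {n} {i j : Fin n} → opposite i ≡ i → opposite j ≡ j → i ≡ j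
opposite-fixed-unique {n} {i} {j} oi oj with ℕ.<-cmp (toℕ i) (toℕ j)
... | tri≈ _ e _ = toℕ-injective e
... | tri< i<j _ _ =
  ⊥-elim (ℕ.<-asym i<j (subst (λ k → k <ᶠ i) oj (subst (opposite j <ᶠ_) oi (opposite-anti-< i<j))))
... | tri> _ _ j<i =
  ⊥-elim (ℕ.<-asym j<i (subst (λ k → k <ᶠ j) oi (subst (opposite i <ᶠ_) oj (opposite-anti-< j<i))))

increasing⇒≤ : ∀ {n} {f : Fin n → Fin n} → StrictlyIncreasing f → ∀ i → toℕ i ≤ toℕ (f i)
increasing⇒≤ {n} {f} inc i = go (toℕ i) i refl
  where
  go : ∀ k i → toℕ i ≡ k → k ≤ toℕ (f i)
  go zero    i eq = z≤n
  go (suc k) i eq = ℕ.≤-<-trans (go k j (toℕ-fromℕ< k<n)) (inc j i j<i)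
    where
    k<n : k ℕ.< n
    k<n = ℕ.<-trans (ℕ.n<1+n k) (subst (ℕ._< n) eq (toℕ<n i))
    j : Fin n
    j = fromℕ< k<n
    j<i : j <ᶠ i
    j<i rewrite toℕ-fromℕ< k<n | eq = ℕ.n<1+n k

-- The lower bound `increasing⇒≤`, applied to the conjugate of `f` by the reversal, becomes the
-- upper bound.
increasing⇒id : ∀ {n} {f : Fin n → Fin n} → StrictlyIncreasing f → ∀ i → f i ≡ i
increasing⇒id {n} {f} inc i with ℕ.m≤n⇒m<n∨m≡n (increasing⇒≤ inc i)
... | inj₂ e   = sym (toℕ-injective e)
... | inj₁ i<f = contradiction (opposite-anti-< i<f) (ℕ.≤⇒≯ oi≤of)
  where
  conj : StrictlyIncreasing (opposite ∘ f ∘ opposite)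
  conj j k j<k = opposite-anti-< (inc _ _ (opposite-anti-< j<k))
  oi≤of : toℕ (opposite i) ≤ toℕ (opposite (f i))
  oi≤of = subst (λ z → toℕ (opposite i) ≤ toℕ (opposite (f z))) (opposite-involutive i)
                (increasing⇒≤ conj (opposite i))

decreasing⇒opposite : ∀ {n} {f : Fin n → Fin n} → StrictlyDecreasing f → ∀ i → f i ≡ opposite i
decreasing⇒opposite {n} {f} dec i =
  trans (sym (opposite-involutive (f i)))
        (cong opposite (increasing⇒id (λ j k j<k → opposite-anti-< (dec j k j<k)) i))

-- The inverse of a permutation as one of its powers.

iterate : ∀ {A : Set} → ℕ → (A → A) → A → A
iterate zero    f x = x
iterate (suc k) f x = f (iterate k f x)

iterate-+ : ∀ {A : Set} i k (f : A → A) x → iterate (i ℕ.+ k) f x ≡ iterate i f (iterate k f x)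
iterate-+ zero    k f x = refl
iterate-+ (suc i) k f x = cong f (iterate-+ i k f x)

-- By pigeonhole two iterates of f agree as functions, so f has finite order.
inverse-is-iterate : ∀ {A : Set} {N} (enc : A → Fin N) (dec : Fin N → A) → (∀ x → dec (enc x) ≡ x) →
  ∀ (f g : A → A) → (∀ x → g (f x) ≡ x) → ∃[ k ] (∀ x → iterate k f x ≡ g x)
inverse-is-iterate {A} {N} enc dec dec-enc f g gf
  with i , j , i<j , eq ← pigeonhole (ℕ.n<1+n (N ℕ.^ N))
         (λ (i : Fin (suc (N ℕ.^ N))) → funToFin (λ x → enc (iterate (toℕ i) f (dec x))))
  = k , λ x → trans (sym (gf _)) (cong g (period x))
  where
  -- One less than the period, so that one further application of `f` gives the identity.
  k : ℕ
  k = toℕ j ℕ.∸ suc (toℕ i)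
  agree : ∀ x → iterate (toℕ i) f x ≡ iterate (toℕ j) f x
  agree x = begin
    iterate (toℕ i) f x                         ≡⟨ dec-enc _ ⟨
    dec (enc (iterate (toℕ i) f x))             ≡⟨ cong (λ z → dec (enc (iterate (toℕ i) f z))) (dec-enc x) ⟨
    dec (enc (iterate (toℕ i) f (dec (enc x)))) ≡⟨ cong dec (finToFun-funToFin (λ x → enc (iterate (toℕ i) f (dec x))) (enc x)) ⟨
    dec (finToFun (funToFin (λ x → enc (iterate (toℕ i) f (dec x)))) (enc x)) ≡⟨ cong (λ h → dec (finToFun h (enc x))) eq ⟩
    dec (finToFun (funToFin (λ x → enc (iterate (toℕ j) f (dec x)))) (enc x)) ≡⟨ cong dec (finToFun-funToFin (λ x → enc (iterate (toℕ j) f (dec x))) (enc x)) ⟩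
    dec (enc (iterate (toℕ j) f (dec (enc x)))) ≡⟨ cong (λ z → dec (enc (iterate (toℕ j) f z))) (dec-enc x) ⟩
    dec (enc (iterate (toℕ j) f x))             ≡⟨ dec-enc _ ⟩
    iterate (toℕ j) f x                         ∎
    where open ≡-Reasoning
  cancel : ∀ i {x y} → iterate i f x ≡ iterate i f y → x ≡ y
  cancel zero    e = e
  cancel (suc i) e = cancel i (trans (sym (gf _)) (trans (cong g e) (gf _)))
  period : ∀ x → f (iterate k f x) ≡ x
  period x = cancel (toℕ i) (begin
    iterate (toℕ i) f (iterate (suc k) f x) ≡⟨ iterate-+ (toℕ i) (suc k) f x ⟨
    iterate (toℕ i ℕ.+ suc k) f x           ≡⟨ cong (λ l → iterate l f x) (trans (ℕ.+-suc (toℕ i) k) (ℕ.m+[n∸m]≡n i<j)) ⟩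
    iterate (toℕ j) f x                     ≡⟨ agree x ⟨
    iterate (toℕ i) f x                     ∎)
    where open ≡-Reasoning

encode : ∀ {n} → Point n → Fin (n ℕ.* (n ℕ.* n))
encode (x , y , z) = combine x (combine y z)

decode : ∀ {n} → Fin (n ℕ.* (n ℕ.* n)) → Point n
decode {n} i = let x , j = remQuot {n} (n ℕ.* n) i in x , remQuot {n} n j

decode-encode : ∀ {n} (p : Point n) → decode (encode p) ≡ p
decode-encode {n} (x , y , z) =
  trans (cong (λ (x , j) → x , remQuot {n} n j) (remQuot-combine {n} {n ℕ.* n} x (combine y z)))
        (cong (x ,_) (remQuot-combine {n} {n} y z))

-- Signs, directions and parametrised lines.

data Axis : Set where
  X Y Z : Axis

data Dir : Set where
  o  : Dir
  mv : Bool → Dir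

mv≢o : ∀ {s} → mv s ≢ o
mv≢o ()

module Cube (m : ℕ) where

  n : ℕ
  n = suc (suc (suc m))

  Pt : Set
  Pt = Point n

  -- `true` is the sign plus and `false` the sign minus.
  sg : Bool → Fin n → Fin n
  sg true  t = t
  sg false t = opposite t

  sg-invol : ∀ s t → sg s (sg s t) ≡ t
  sg-invol true  t = refl
  sg-invol false t = opposite-involutive t

  sg-inj : ∀ s {t u} → sg s t ≡ sg s u → t ≡ u
  sg-inj s {t} {u} e = trans (sym (sg-invol s t)) (trans (cong (sg s) e) (sg-invol s u))

  sg-not : ∀ s t → sg (not s) t ≡ opposite (sg s t)
  sg-not true  t = refl
  sg-not false t = sym (opposite-involutive t)

  _⊗_ : Bool → Bool → Bool
  true  ⊗ s = s
  false ⊗ s = not s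

  sg-⊗ : ∀ s s′ t → sg (s ⊗ s′) t ≡ sg s (sg s′ t)
  sg-⊗ true  s′ t = refl
  sg-⊗ false s′ t = sg-not s′ t

  sg-flip : ∀ s {t u} → sg s t ≡ u → t ≡ sg s u
  sg-flip s {t} e = trans (sym (sg-invol s t)) (cong (sg s) e)

  sg-inj-sign : ∀ {a} → a ≢ opposite a → ∀ s s′ → sg s a ≡ sg s′ a → s ≡ s′
  sg-inj-sign ne true  true  e = refl
  sg-inj-sign ne true  false e = contradiction e ne
  sg-inj-sign ne false true  e = contradiction (sym e) ne
  sg-inj-sign ne false false e = refl

  O N : Fin n
  O = zero
  N = opposite zero

  O≢N : O ≢ N
  O≢N ()

  _∼_ : Fin n → Fin n → Set
  t ∼ u = ∃[ s ] t ≡ sg s u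

  ∼-sym : ∀ {t u} → t ∼ u → u ∼ t
  ∼-sym (s , e) = s , sg-flip s (sym e)

  ∼-trans : ∀ {t u v} → t ∼ u → u ∼ v → t ∼ v
  ∼-trans {v = v} (s , refl) (s′ , refl) = s ⊗ s′ , sym (sg-⊗ s s′ v)

  sg-∼ : ∀ s {t u} → sg s t ∼ u → t ∼ u
  sg-∼ s r = ∼-trans (s , sym (sg-invol s _)) r

  _∼?_ : ∀ t u → Dec (t ∼ u)
  t ∼? u with t ≟ u | t ≟ opposite u
  ... | yes e | _     = yes (true , e)
  ... | no _  | yes e = yes (false , e)
  ... | no ¬e | no ¬f = no λ { (true , e) → ¬e e ; (false , e) → ¬f e }

  one : Fin n
  one = suc zero

  -- Here n >= 3 enters: the value 1 differs from n - 1.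
  one≁O : ¬ (one ∼ O)
  one≁O (true , ())
  one≁O (false , ())

  ∃≁ : ∀ c → ∃[ v ] ¬ (v ∼ c)
  ∃≁ c with c ∼? O
  ... | yes r = one , λ r′ → one≁O (∼-trans r′ r)
  ... | no ¬r = O , λ r′ → ¬r (∼-sym r′)

  coord : Axis → Pt → Fin n
  coord X = xc
  coord Y = yc
  coord Z = zc

  mk : (Axis → Fin n) → Pt
  mk f = f X , f Y , f Z

  coord-mk : ∀ f c → coord c (mk f) ≡ f c
  coord-mk f X = refl
  coord-mk f Y = refl
  coord-mk f Z = refl

  pt-ext : ∀ {p q : Pt} → (∀ c → coord c p ≡ coord c q) → p ≡ q
  pt-ext {p} {q} e = cong₂ _,_ (e X) (cong₂ _,_ (e Y) (e Z))

  ap : Dir → Fin n → Fin n → Fin n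
  ap o      b t = b
  ap (mv s) b t = sg s t

  -- The line through p in which the coordinates of direction o are frozen and
  -- those of direction mv s run through sg s t; p lies on it only if Valid p d.
  line : Pt → (Axis → Dir) → Fin n → Pt
  line p d t = mk (λ c → ap (d c) (coord c p) t)

  coord-line : ∀ p d t c → coord c (line p d t) ≡ ap (d c) (coord c p) t
  coord-line p d t = coord-mk _

  Valid : Pt → (Axis → Dir) → Set
  Valid p d = ∃[ t ] line p d t ≡ p

  NonConst Main : (Axis → Dir) → Set
  NonConst d = ∃[ c ] ∃[ s ] d c ≡ mv s
  Main d = ∀ c → ∃[ s ] d c ≡ mv s

  line-inj : ∀ p d {c s t u} → d c ≡ mv s → coord c (line p d t) ≡ coord c (line p d u) → t ≡ u
  line-inj p d {c} {s} {t} {u} e eq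
    with eq′ ← trans (sym (coord-line p d t c)) (trans eq (coord-line p d u c))
    rewrite e = sg-inj s eq′

  main-or-flat : ∀ d → Main d ⊎ (∃[ c ] d c ≡ o)
  main-or-flat d with d X in ex | d Y in ey | d Z in ez
  ... | o    | _    | _    = inj₂ (X , ex)
  ... | mv _ | o    | _    = inj₂ (Y , ey)
  ... | mv _ | mv _ | o    = inj₂ (Z , ez)
  ... | mv a | mv b | mv c = inj₁ λ { X → a , ex ; Y → b , ey ; Z → c , ez }

  nonConst-or-const : ∀ d → NonConst d ⊎ (∀ c → d c ≡ o)
  nonConst-or-const d with d X in ex | d Y in ey | d Z in ez
  ... | mv s | _    | _    = inj₁ (X , s , ex)
  ... | o    | mv s | _    = inj₁ (Y , s , ey)
  ... | o    | o    | mv s = inj₁ (Z , s , ez)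
  ... | o    | o    | o    = inj₂ λ { X → ex ; Y → ey ; Z → ez }

  -- Maps carrying lines to lines.

  -- The image line is based at `f p`, and equality of point sets is split into two inclusions, so
  -- that the change of parameter may be arbitrary.
  LineMap : (Pt → Pt) → Set
  LineMap f = ∀ p d → NonConst d → Valid p d → ∃[ d′ ] (NonConst d′
    × (∀ t → ∃[ t′ ] f (line p d t) ≡ line (f p) d′ t′)
    × (∀ t′ → ∃[ t ] f (line p d t) ≡ line (f p) d′ t′))

  valid-image : ∀ (f : Pt → Pt) p d d′ → Valid p d →
    (∀ t → ∃[ t′ ] f (line p d t) ≡ line (f p) d′ t′) → Valid (f p) d′
  valid-image f p d d′ (t₀ , e) fw with t′ , e′ ← fw t₀ = t′ , trans (sym e′) (cong f e)

  LineMap-id : LineMap id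
  LineMap-id p d nz v = d , nz , (λ t → t , refl) , (λ t → t , refl)

  LineMap-∘ : ∀ {f g} → LineMap f → LineMap g → LineMap (g ∘ f)
  LineMap-∘ {f} {g} F G p d nz v
    with d′ , nz′ , fw , bw ← F p d nz v
    with d″ , nz″ , fw′ , bw′ ← G (f p) d′ nz′ (valid-image f p d d′ v fw)
    = d″ , nz″
    , (λ t → let t′ , e = fw t ; t″ , e′ = fw′ t′ in t″ , trans (cong g e) e′)
    , (λ t″ → let t′ , e′ = bw′ t″ ; t , e = bw t′ in t , trans (cong g e) e′)

  LineMap-resp : ∀ {f g} → f ≗ g → LineMap f → LineMap g
  LineMap-resp {f} {g} f≗g F p d nz v
    with d′ , nz′ , fw , bw ← F p d nz v
    = d′ , nz′
    , (λ t → let t′ , e = fw t in t′ , conv _ d′ t′ e)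
    , (λ t′ → let t , e = bw t′ in t , conv _ d′ t′ e)
    where
    conv : ∀ q d′ t′ → f q ≡ line (f p) d′ t′ → g q ≡ line (g p) d′ t′
    conv q d′ t′ e = trans (sym (f≗g q)) (trans e (cong (λ r → line r d′ t′) (f≗g p)))

  LineMap-iterate : ∀ {f} k → LineMap f → LineMap (iterate k f)
  LineMap-iterate zero    F = LineMap-id
  LineMap-iterate (suc k) F = LineMap-∘ (LineMap-iterate k F) F

  record Aut : Set where
    field
      to from    : Pt → Pt
      to-from    : ∀ p → to (from p) ≡ p
      from-to    : ∀ p → from (to p) ≡ p
      to-lines   : LineMap to
      from-lines : LineMap from

    to-inj : ∀ {p q} → to p ≡ to q → p ≡ q
    to-inj e = trans (sym (from-to _)) (trans (cong from e) (from-to _))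

  open Aut

  _⁻¹ : Aut → Aut
  T ⁻¹ = record
    { to = from T ; from = to T ; to-from = from-to T ; from-to = to-from T
    ; to-lines = from-lines T ; from-lines = to-lines T }

  infixl 5 _⨟_
  _⨟_ : Aut → Aut → Aut
  T ⨟ S = record
    { to = to S ∘ to T
    ; from = from T ∘ from S
    ; to-from = λ p → trans (cong (to S) (to-from T _)) (to-from S p)
    ; from-to = λ p → trans (cong (from T) (from-to S _)) (from-to T p)
    ; to-lines = LineMap-∘ (to-lines T) (to-lines S)
    ; from-lines = LineMap-∘ (from-lines S) (from-lines T) }

  -- The inverse maps lines to lines because it is a power of the map itself.
  aut : (f g : Pt → Pt) → (∀ p → f (g p) ≡ p) → (∀ p → g (f p) ≡ p) → LineMap f → Aut
  aut f g fg gf F = record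
    { to = f ; from = g ; to-from = fg ; from-to = gf ; to-lines = F
    ; from-lines = let k , e = inverse-is-iterate encode decode decode-encode f g gf
                   in LineMap-resp e (LineMap-iterate k F) }

  -- From line orderings to directions and back.

  monotone⇒ap : ∀ {f : Fin n → Fin n} → Monotone f → ∃[ d ] (∀ t₀ t → f t ≡ ap d (f t₀) t)
  monotone⇒ap (inj₁ inc)        = mv true , λ t₀ → increasing⇒id inc
  monotone⇒ap (inj₂ (inj₁ dec)) = mv false , λ t₀ → decreasing⇒opposite dec
  monotone⇒ap (inj₂ (inj₂ con)) = o , λ t₀ t → con t t₀

  ap-monotone : ∀ d b → Monotone (ap d b)
  ap-monotone o          b = inj₂ (inj₂ λ _ _ → refl)
  ap-monotone (mv true)  b = inj₁ λ _ _ i<j → i<j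
  ap-monotone (mv false) b = inj₂ (inj₁ λ _ _ → opposite-anti-<)

  -- The index `t₀` is left free so that the line can be based at any of its points.
  ordering⇒line : ∀ {q : Fin n → Pt} → IsLineOrdering q →
    ∃[ d ] (NonConst d × (∀ t₀ t → q t ≡ line (q t₀) d t))
  ordering⇒line {q} (_ , mx , my , mz , ¬const)
    with dx , ex ← monotone⇒ap mx | dy , ey ← monotone⇒ap my | dz , ez ← monotone⇒ap mz
    = d , nonConst dx dy dz refl refl refl , λ t₀ t → pt-ext λ { X → ex t₀ t ; Y → ey t₀ t ; Z → ez t₀ t }
    where
    d : Axis → Dir
    d X = dx
    d Y = dy
    d Z = dz
    nonConst : ∀ a b c → dx ≡ a → dy ≡ b → dz ≡ c → NonConst d
    nonConst (mv s) _ _ e _ _ = X , s , e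
    nonConst o (mv s) _ _ e _ = Y , s , e
    nonConst o o (mv s) _ _ e = Z , s , e
    nonConst o o o refl refl refl =
      contradiction ((λ i j → ex j i) , (λ i j → ey j i) , (λ i j → ez j i)) ¬const

  line-ordering : ∀ p d → NonConst d → IsLineOrdering (line p d)
  line-ordering p d (c , s , e) =
    (λ eq → line-inj p d e (cong (coord c) eq))
    , ap-monotone (d X) _ , ap-monotone (d Y) _ , ap-monotone (d Z) _ , ¬const c e
    where
    ne : sg s O ≢ sg s N
    ne eq = O≢N (sg-inj s eq)
    ¬const : ∀ c → d c ≡ mv s →
      ¬ (Constant (λ i → xc (line p d i)) × Constant (λ i → yc (line p d i)) × Constant (λ i → zc (line p d i)))
    ¬const X e (k , _ , _) with d X | e
    ... | _ | refl = ne (k O N)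
    ¬const Y e (_ , k , _) with d Y | e
    ... | _ | refl = ne (k O N)
    ¬const Z e (_ , _ , k) with d Z | e
    ... | _ | refl = ne (k O N)

  automorphism⇒aut : Automorphism {n} → Aut
  automorphism⇒aut T = aut f (Inverse.from perm) (λ p → Inverse.inverseˡ perm refl) (λ p → Inverse.inverseʳ perm refl) F
    where
    open Automorphism T
    f : Pt → Pt
    f = Inverse.to perm
    F : LineMap f
    F p d nz (t₀ , v)
      with q , ord , image⇔ ← lines (λ r → ∃[ t ] line p d t ≡ r) (line p d , line-ordering p d nz , λ r → mk⇔ id id)
      with d′ , nz′ , q≡ ← ordering⇒line ord
      -- The index of `f p` on the image line; it moves the base point there.
      with i₀ , e₀ ← Equivalence.to (image⇔ (f p)) (p , (t₀ , v) , refl)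
      = d′ , nz′ , fw , bw
      where
      q≡′ : ∀ t → q t ≡ line (f p) d′ t
      q≡′ t = subst (λ r → q t ≡ line r d′ t) e₀ (q≡ i₀ t)
      fw : ∀ t → ∃[ t′ ] f (line p d t) ≡ line (f p) d′ t′
      fw t with i , e ← Equivalence.to (image⇔ (f (line p d t))) (line p d t , (t , refl) , refl)
        = i , trans (sym e) (q≡′ i)
      bw : ∀ t′ → ∃[ t ] f (line p d t) ≡ line (f p) d′ t′
      bw t′ with r , (t , e) , e′ ← Equivalence.from (image⇔ (q t′)) (t′ , refl)
        = t , trans (cong f e) (trans e′ (q≡′ t′))

  -- Symmetries of the cube.

  -- Criterion for the three kinds of symmetry below: one rule for directions and one permutation of
  -- the parameter serve all lines.
  reindexed-LineMap : ∀ {f : Pt → Pt} (D : (Axis → Dir) → (Axis → Dir)) (π : Fin n ↔ Fin n) →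
    (∀ d → NonConst d → NonConst (D d)) →
    (∀ p d t → f (line p d t) ≡ line (f p) (D d) (Inverse.to π t)) → LineMap f
  reindexed-LineMap D π nzD eq p d nz v =
    D d , nzD d nz , (λ t → Inverse.to π t , eq p d t)
    , λ t′ → Inverse.from π t′ , trans (eq p d _) (cong (line _ (D d)) (Inverse.inverseˡ π refl))

  id↔ : Fin n ↔ Fin n
  id↔ = mk↔ₛ′ id id (λ _ → refl) (λ _ → refl)

  permute : (σ : Axis → Axis) → (∀ c → σ (σ c) ≡ c) → Aut
  permute σ σσ = aut f f ff ff (reindexed-LineMap (_∘ σ) id↔ nz commute)
    where
    f : Pt → Pt
    f p = mk (λ c → coord (σ c) p)
    coord-f : ∀ p c → coord c (f p) ≡ coord (σ c) p
    coord-f p = coord-mk _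
    ff : ∀ p → f (f p) ≡ p
    ff p = pt-ext λ c → trans (coord-f (f p) c) (trans (coord-f p (σ c)) (cong (λ c → coord c p) (σσ c)))
    nz : ∀ d → NonConst d → NonConst (d ∘ σ)
    nz d (c , s , e) = σ c , s , trans (cong d (σσ c)) e
    commute : ∀ p d t → f (line p d t) ≡ line (f p) (d ∘ σ) t
    commute p d t = pt-ext λ c → trans (coord-f _ c) (trans (coord-line p d t (σ c))
      (trans (cong (λ r → ap (d (σ c)) r t) (sym (coord-f p c))) (sym (coord-line (f p) (d ∘ σ) t c))))

  flip-dir : Bool → Dir → Dir
  flip-dir s o       = o
  flip-dir s (mv s′) = mv (s ⊗ s′)

  reflect : (Axis → Bool) → Aut
  reflect b = aut f f ff ff (reindexed-LineMap D id↔ nz commute)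
    where
    f : Pt → Pt
    f p = mk (λ c → sg (b c) (coord c p))
    D : (Axis → Dir) → (Axis → Dir)
    D d c = flip-dir (b c) (d c)
    coord-f : ∀ p c → coord c (f p) ≡ sg (b c) (coord c p)
    coord-f p = coord-mk _
    ff : ∀ p → f (f p) ≡ p
    ff p = pt-ext λ c → trans (coord-f (f p) c) (trans (cong (sg (b c)) (coord-f p c)) (sg-invol (b c) _))
    nz : ∀ d → NonConst d → NonConst (D d)
    nz d (c , s , e) = c , b c ⊗ s , cong (flip-dir (b c)) e
    ap-flip : ∀ s e x t → sg s (ap e x t) ≡ ap (flip-dir s e) (sg s x) t
    ap-flip s o       x t = refl
    ap-flip s (mv s′) x t = sym (sg-⊗ s s′ t)
    commute : ∀ p d t → f (line p d t) ≡ line (f p) (D d) t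
    commute p d t = pt-ext λ c → trans (coord-f _ c) (trans (cong (sg (b c)) (coord-line p d t c))
      (trans (ap-flip (b c) (d c) _ t)
      (trans (cong (λ r → ap (D d c) r t) (sym (coord-f p c))) (sym (coord-line (f p) (D d) t c)))))

  relabel : (π : Fin n ↔ Fin n) → SymmetricPerm π → Aut
  relabel π πsym = aut (Fπ π) g fg gf (reindexed-LineMap id π (λ _ nz → nz) commute)
    where
    g : Pt → Pt
    g (x , y , z) = Inverse.from π x , Inverse.from π y , Inverse.from π z
    fg : ∀ p → Fπ π (g p) ≡ p
    fg p = pt-ext λ { X → Inverse.inverseˡ π refl ; Y → Inverse.inverseˡ π refl ; Z → Inverse.inverseˡ π refl }
    gf : ∀ p → g (Fπ π p) ≡ p
    gf p = pt-ext λ { X → Inverse.inverseʳ π refl ; Y → Inverse.inverseʳ π refl ; Z → Inverse.inverseʳ π refl }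
    -- The symmetry of `π` enters at coordinates that run backwards.
    ap-π : ∀ e x t → Inverse.to π (ap e x t) ≡ ap e (Inverse.to π x) (Inverse.to π t)
    ap-π o          x t = refl
    ap-π (mv true)  x t = refl
    ap-π (mv false) x t = πsym t
    commute : ∀ p d t → Fπ π (line p d t) ≡ line (Fπ π p) d (Inverse.to π t)
    commute p d t = pt-ext λ { X → ap-π (d X) _ t ; Y → ap-π (d Y) _ t ; Z → ap-π (d Z) _ t }

  axes : ∀ {A : Set} → A → A → A → Axis → A
  axes a b c X = a
  axes a b c Y = b
  axes a b c Z = c

  swapXY swapYZ : Aut
  swapXY = permute (axes Y X Z) λ { X → refl ; Y → refl ; Z → refl }
  swapYZ = permute (axes X Z Y) λ { X → refl ; Y → refl ; Z → refl }

  -- Counting lines through a point.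

  -- A bound on the number of lines through `p`, put in terms of incidence so that automorphisms
  -- preserve it. Six separates the diagonal points, with at least seven lines, from the others,
  -- with at most five.
  record Star (p : Pt) : Set where
    field
      dir      : Fin 6 → Axis → Dir
      nonConst : ∀ i → NonConst (dir i)
      valid    : ∀ i → Valid p (dir i)
      meet     : ∀ {i j} → i ≢ j → ∀ t u → line p (dir i) t ≡ line p (dir j) u → line p (dir i) t ≡ p

  -- A common point of two image lines pulls back to a common point of the original lines.
  star-map : ∀ (T : Aut) {p} → Star p → Star (to T p)
  star-map T {p} S = record
    { dir = D ; nonConst = λ i → proj₁ (proj₂ (image i))
    ; valid = λ i → valid-image (to T) p (dir i) (D i) (valid i) (proj₁ (proj₂ (proj₂ (image i))))
    ; meet = meet′ }
    where
    open Star S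
    image : ∀ i → _
    image i = to-lines T p (dir i) (nonConst i) (valid i)
    D : Fin 6 → Axis → Dir
    D i = proj₁ (image i)
    onto : ∀ i t → ∃[ u ] to T (line p (dir i) u) ≡ line (to T p) (D i) t
    onto i = proj₂ (proj₂ (proj₂ (image i)))
    meet′ : ∀ {i j} → i ≢ j → ∀ t u → line (to T p) (D i) t ≡ line (to T p) (D j) u → line (to T p) (D i) t ≡ to T p
    meet′ {i} {j} i≢j t u e with t′ , et ← onto i t | u′ , eu ← onto j u =
      trans (sym et) (cong (to T) (meet i≢j t′ u′ (to-inj T (trans et (trans e (sym eu))))))

  -- The moving axes range over the six nonempty proper sets of axes; every line passes through the
  -- point at parameter `a`.
  star-diagonal : ∀ a → Star (a , a , a)
  star-diagonal a = record
    { dir = λ i → dir′ i ; nonConst = nz ; valid = λ i → a , valid′ i ; meet = meet′ }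
    where
    tab : Fin 6 → Axis → Bool
    tab zero                               = axes true false false
    tab (suc zero)                         = axes false true false
    tab (suc (suc zero))                   = axes false false true
    tab (suc (suc (suc zero)))             = axes true true false
    tab (suc (suc (suc (suc zero))))       = axes true false true
    tab (suc (suc (suc (suc (suc zero))))) = axes false true true
    -- A left inverse of `tab`, showing its rows distinct; the wildcards absorb the two constant
    -- triples outside the table.
    index : Bool → Bool → Bool → Fin 6
    index true  false false = zero
    index false true  false = suc zero
    index false false _     = suc (suc zero)
    index true  true  _     = suc (suc (suc zero))
    index true  false true  = suc (suc (suc (suc zero)))
    index false true  true  = suc (suc (suc (suc (suc zero))))
    index-tab : ∀ i → index (tab i X) (tab i Y) (tab i Z) ≡ i
    index-tab zero                               = refl
    index-tab (suc zero)                         = refl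
    index-tab (suc (suc zero))                   = refl
    index-tab (suc (suc (suc zero)))             = refl
    index-tab (suc (suc (suc (suc zero))))       = refl
    index-tab (suc (suc (suc (suc (suc zero))))) = refl
    distinguish : ∀ {i j} → i ≢ j → ∃[ c ] tab i c ≢ tab j c
    distinguish {i} {j} i≢j
      with tab i X ≟ᵇ tab j X | tab i Y ≟ᵇ tab j Y | tab i Z ≟ᵇ tab j Z
    ... | no e  | _     | _     = X , e
    ... | yes _ | no e  | _     = Y , e
    ... | yes _ | yes _ | no e  = Z , e
    ... | yes x | yes y | yes z = contradiction
      (trans (sym (index-tab i)) (trans (cong₂ (λ f z → f z) (cong₂ index x y) z) (index-tab j))) i≢j
    p : Pt
    p = a , a , a
    coord-p : ∀ c → coord c p ≡ a
    coord-p X = refl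
    coord-p Y = refl
    coord-p Z = refl
    dirOf : Bool → Dir
    dirOf true  = mv true
    dirOf false = o
    dir′ : Fin 6 → Axis → Dir
    dir′ i c = dirOf (tab i c)
    nz : ∀ i → NonConst (dir′ i)
    nz zero                               = X , true , refl
    nz (suc zero)                         = Y , true , refl
    nz (suc (suc zero))                   = Z , true , refl
    nz (suc (suc (suc zero)))             = X , true , refl
    nz (suc (suc (suc (suc zero))))       = X , true , refl
    nz (suc (suc (suc (suc (suc zero))))) = Y , true , refl
    ap-dirOf : ∀ b → ap (dirOf b) a a ≡ a
    ap-dirOf true  = refl
    ap-dirOf false = refl
    valid′ : ∀ i → line p (dir′ i) a ≡ p
    valid′ i = pt-ext λ c → trans (coord-line p (dir′ i) a c)
      (trans (cong (λ r → ap (dir′ i c) r a) (coord-p c)) (trans (ap-dirOf (tab i c)) (sym (coord-p c))))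
    -- On an axis where just one of the two lines moves, the other has the value `a`, which forces
    -- the parameter of the moving one.
    meet′ : ∀ {i j} → i ≢ j → ∀ t u → line p (dir′ i) t ≡ line p (dir′ j) u → line p (dir′ i) t ≡ p
    meet′ {i} {j} i≢j t u e
      with c , ne ← distinguish i≢j
      with e′ ← trans (sym (coord-line p (dir′ i) t c)) (trans (cong (coord c) e) (coord-line p (dir′ j) u c))
      rewrite coord-p c
      with tab i c | tab j c
    ... | true  | true  = contradiction refl ne
    ... | false | false = contradiction refl ne
    ... | true  | false = trans (cong (line p (dir′ i)) e′) (valid′ i)
    ... | false | true  = trans e (trans (cong (line p (dir′ j)) (sym e′)) (valid′ j))

  -- The directions possible when the third coordinate is unrelated to the other two. In `xy r s`,
  -- `r` is the relative sign of the moving coordinates and `s` the orientation; `class` forgets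
  -- orientation, leaving five lines.
  data Admissible : Dir → Dir → Dir → Set where
    x-axis : ∀ s → Admissible (mv s) o o
    y-axis : ∀ s → Admissible o (mv s) o
    z-axis : ∀ s → Admissible o o (mv s)
    xy     : ∀ r s → Admissible (mv s) (mv (r ⊗ s)) o

  class : ∀ {a b c} → Admissible a b c → Fin 5
  class (x-axis _)   = zero
  class (y-axis _)   = suc zero
  class (z-axis _)   = suc (suc zero)
  class (xy true _)  = suc (suc (suc zero))
  class (xy false _) = suc (suc (suc (suc zero)))

  ⊗-cancel : ∀ r s s′ → r ⊗ s′ ≡ (s ⊗ s′) ⊗ (r ⊗ s)
  ⊗-cancel true  true  true  = refl
  ⊗-cancel true  true  false = refl
  ⊗-cancel true  false true  = refl
  ⊗-cancel true  false false = refl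
  ⊗-cancel false true  true  = refl
  ⊗-cancel false true  false = refl
  ⊗-cancel false false true  = refl
  ⊗-cancel false false false = refl

  class-determines : ∀ {a b c a′ b′ c′} (A : Admissible a b c) (A′ : Admissible a′ b′ c′) → class A ≡ class A′ →
    ∃[ r ] (a′ ≡ flip-dir r a × b′ ≡ flip-dir r b × c′ ≡ flip-dir r c)
  class-determines (x-axis s) (x-axis s′) e = s ⊗ s′ , cong mv (⊗-cancel true s s′) , refl , refl
  class-determines (y-axis s) (y-axis s′) e = s ⊗ s′ , refl , cong mv (⊗-cancel true s s′) , refl
  class-determines (z-axis s) (z-axis s′) e = s ⊗ s′ , refl , refl , cong mv (⊗-cancel true s s′)
  class-determines (xy true s) (xy true s′) e =
    s ⊗ s′ , cong mv (⊗-cancel true s s′) , cong mv (⊗-cancel true s s′) , refl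
  class-determines (xy false s) (xy false s′) e =
    s ⊗ s′ , cong mv (⊗-cancel true s s′) , cong mv (⊗-cancel false s s′) , refl
  class-determines (x-axis _) (y-axis _) ()
  class-determines (x-axis _) (z-axis _) ()
  class-determines (x-axis _) (xy true _) ()
  class-determines (x-axis _) (xy false _) ()
  class-determines (y-axis _) (x-axis _) ()
  class-determines (y-axis _) (z-axis _) ()
  class-determines (y-axis _) (xy true _) ()
  class-determines (y-axis _) (xy false _) ()
  class-determines (z-axis _) (x-axis _) ()
  class-determines (z-axis _) (y-axis _) ()
  class-determines (z-axis _) (xy true _) ()
  class-determines (z-axis _) (xy false _) ()
  class-determines (xy true _) (x-axis _) ()
  class-determines (xy true _) (y-axis _) ()
  class-determines (xy true _) (z-axis _) ()
  class-determines (xy true _) (xy false _) ()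
  class-determines (xy false _) (x-axis _) ()
  class-determines (xy false _) (y-axis _) ()
  class-determines (xy false _) (z-axis _) ()
  class-determines (xy false _) (xy true _) ()

  flip-reparam : ∀ r e x t → ap e x t ≡ ap (flip-dir r e) x (sg r t)
  flip-reparam r     o          x t = refl
  flip-reparam true  (mv s)     x t = refl
  flip-reparam false (mv true)  x t = sym (opposite-involutive t)
  flip-reparam false (mv false) x t = refl

  -- Both coordinates are, up to sign, the parameter at which the line passes through `p`.
  valid-∼ : ∀ p d → Valid p d → ∀ c c′ {s s′} → d c ≡ mv s → d c′ ≡ mv s′ → coord c p ∼ coord c′ p
  valid-∼ p d (t , v) c c′ {s} {s′} e e′ =
    ∼-trans (s , at c e) (∼-sym (s′ , at c′ e′))
    where
    at : ∀ c {s} → d c ≡ mv s → coord c p ≡ sg s t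
    at c e = trans (cong (coord c) (sym v)) (trans (coord-line p d t c) (cong (λ k → ap k (coord c p) t) e))

  admissible : ∀ {x y z} → ¬ (x ∼ z) → ¬ (y ∼ z) → ∀ {d} → NonConst d → Valid (x , y , z) d →
    Admissible (d X) (d Y) (d Z)
  admissible {x} {y} {z} ¬xz ¬yz {d} (c , s , e) v = go (d X) (d Y) (d Z) refl refl refl
    where
    related : ∀ c c′ {s s′} → d c ≡ mv s → d c′ ≡ mv s′ → coord c (x , y , z) ∼ coord c′ (x , y , z)
    related = valid-∼ (x , y , z) d v
    go : ∀ a b c → d X ≡ a → d Y ≡ b → d Z ≡ c → Admissible a b c
    go (mv _) _      (mv _) ex ey ez = contradiction (related X Z ex ez) ¬xz
    go o      (mv _) (mv _) ex ey ez = contradiction (related Y Z ey ez) ¬yz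
    go (mv s) o      o      ex ey ez = x-axis s
    go o      (mv s) o      ex ey ez = y-axis s
    go o      o      (mv s) ex ey ez = z-axis s
    go (mv s) (mv r) o      ex ey ez =
      -- `s ⊗ r` is the relative sign of the two moving coordinates.
      subst (λ r → Admissible (mv s) (mv r) o) (sym (⊗-cancel true s r)) (xy (s ⊗ r) s)
    go o      o      o      ex ey ez = ⊥-elim (absurd c e)
      where
      absurd : ∀ c → d c ≡ mv s → ⊥
      absurd X e = mv≢o (trans (sym e) ex)
      absurd Y e = mv≢o (trans (sym e) ey)
      absurd Z e = mv≢o (trans (sym e) ez)

  -- By pigeonhole two of the six lines share a class, so they are one line up to orientation.
  -- Meeting itself only in `p`, it would consist of `p` alone.
  no-star : ∀ {x y z} → ¬ (x ∼ z) → ¬ (y ∼ z) → ¬ Star (x , y , z)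
  no-star {x} {y} {z} ¬xz ¬yz S
    with i , j , i<j , e ← pigeonhole (ℕ.n<1+n 5) (λ i → class (admissible ¬xz ¬yz (Star.nonConst S i) (Star.valid S i)))
    with r , ex , ey , ez ← class-determines (admissible ¬xz ¬yz (Star.nonConst S i) (Star.valid S i)) (admissible ¬xz ¬yz (Star.nonConst S j) (Star.valid S j)) e
    with c , s , ec ← Star.nonConst S i
    = O≢N (line-inj p (dir i) ec (cong (coord c) (trans (all-p O) (sym (all-p N)))))
    where
    open Star S
    p : Pt
    p = x , y , z
    flipped : ∀ c → dir j c ≡ flip-dir r (dir i c)
    flipped X = ex
    flipped Y = ey
    flipped Z = ez
    all-p : ∀ t → line p (dir i) t ≡ p
    all-p t = meet (<⇒≢ i<j) t (sg r t) (pt-ext λ c → trans (coord-line p (dir i) t c)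
      (trans (flip-reparam r (dir i c) _ t) (trans (cong (λ k → ap k (coord c p) (sg r t)) (sym (flipped c)))
      (sym (coord-line p (dir j) (sg r t) c)))))

  -- Diagonal points and their cubes.

  -- For `a` equal to `O` these points are the corners, and negating `b` gives the antipode.
  cu : Fin n → (Axis → Bool) → Pt
  cu a b = mk (λ c → sg (b c) a)

  coord-cu : ∀ a b c → coord c (cu a b) ≡ sg (b c) a
  coord-cu a b = coord-mk _

  cu-cong : ∀ a b a′ b′ → (∀ c → sg (b c) a ≡ sg (b′ c) a′) → cu a b ≡ cu a′ b′
  cu-cong a b a′ b′ e = pt-ext λ c → trans (coord-cu a b c) (trans (e c) (sym (coord-cu a′ b′ c)))

  OnCube : Fin n → Pt → Set
  OnCube a p = ∃[ b ] p ≡ cu a b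

  OnDiagonal : Pt → Set
  OnDiagonal p = ∃[ a ] OnCube a p

  coords-∼⇒cube : ∀ {p a} → (∀ c → coord c p ∼ a) → OnCube a p
  coords-∼⇒cube {p} {a} rel = signs , pt-ext λ c → trans (proj₂ (rel c)) (sym (coord-cu a signs c))
    where
    signs : Axis → Bool
    signs c = proj₁ (rel c)

  cube⇒coord-∼ : ∀ {p a} → OnCube a p → ∀ c → coord c p ∼ a
  cube⇒coord-∼ {p} {a} (b , e) c = b c , trans (cong (coord c) e) (coord-cu a b c)

  diagonal-∼ : ∀ {p} → OnDiagonal p → ∀ c c′ → coord c p ∼ coord c′ p
  diagonal-∼ {p} (a , b , refl) c c′ = ∼-trans (b c , coord-cu a b c) (∼-sym (b c′ , coord-cu a b c′))

  diagonal-at : ∀ {p a} → OnDiagonal p → ∀ c → coord c p ∼ a → OnCube a p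
  diagonal-at {p} {a} D c r = coords-∼⇒cube {p} {a} λ c′ → ∼-trans (diagonal-∼ D c′ c) r

  abstract
    -- Any two of the three relations between coordinates make the point diagonal. If two fail, an
    -- axis permutation puts the unrelated coordinate last, where `no-star` applies.
    star⇒diagonal : ∀ {p} → Star p → OnDiagonal p
    star⇒diagonal {x , y , z} S with x ∼? y | x ∼? z | y ∼? z
    ... | yes (s , e) | yes (s′ , e′) | _           =
      x , axes true s s′ , pt-ext λ { X → refl ; Y → sg-flip s (sym e) ; Z → sg-flip s′ (sym e′) }
    ... | yes (s , e) | no _         | yes (s′ , e′) =
      y , axes s true s′ , pt-ext λ { X → e ; Y → refl ; Z → sg-flip s′ (sym e′) }
    ... | no _        | yes (s , e)  | yes (s′ , e′) =
      z , axes s s′ true , pt-ext λ { X → e ; Y → e′ ; Z → refl }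
    ... | _      | no ¬xz | no ¬yz = contradiction S (no-star ¬xz ¬yz)
    ... | no ¬xy | _      | no ¬yz = contradiction (star-map swapYZ S) (no-star ¬xy (¬yz ∘ ∼-sym))
    ... | no ¬xy | no ¬xz | _      =
      contradiction (star-map (swapXY ⨟ swapYZ) S) (no-star (¬xy ∘ ∼-sym) (¬xz ∘ ∼-sym))

  -- A reflection takes (a, a, a), which has a star, to the given point; stars travel along
  -- automorphisms.
  diagonal-map : ∀ (T : Aut) {p} → OnDiagonal p → OnDiagonal (to T p)
  diagonal-map T (a , b , refl) =
    star⇒diagonal (star-map (reflect b ⨟ T) (star-diagonal a))

  main⇒diagonal : ∀ p d → Main d → ∀ t → OnDiagonal (line p d t)
  main⇒diagonal p d M t = t , (λ c → proj₁ (M c)) , pt-ext λ c →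
    trans (coord-line p d t c) (trans (cong (λ k → ap k (coord c p) t) (proj₂ (M c))) (sym (coord-cu t (λ c → proj₁ (M c)) c)))

  coord-flat : ∀ p d {c} → d c ≡ o → ∀ t → coord c (line p d t) ≡ coord c p
  coord-flat p d {c} e t = trans (coord-line p d t c) (cong (λ k → ap k (coord c p) t) e)

  coord-mv : ∀ p d {c s} → d c ≡ mv s → ∀ t → coord c (line p d t) ≡ sg s t
  coord-mv p d {c} e t = trans (coord-line p d t c) (cong (λ k → ap k (coord c p) t) e)

  -- Were one coordinate frozen, a moving one would somewhere take a value unrelated to it, and that
  -- point would not be diagonal.
  all-diagonal⇒main : ∀ p d → NonConst d → (∀ t → OnDiagonal (line p d t)) → Main d
  all-diagonal⇒main p d (c′ , s , e′) D with main-or-flat d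
  ... | inj₁ M       = M
  ... | inj₂ (c , e) with v , v≁ ← ∃≁ (coord c p) = contradiction rel v≁
    where
    rel : v ∼ coord c p
    rel = subst (_∼ coord c p) (trans (coord-mv p d e′ (sg s v)) (sg-invol s v))
            (subst (coord c′ (line p d (sg s v)) ∼_) (coord-flat p d e (sg s v)) (diagonal-∼ (D (sg s v)) c′ c))

  -- Images of main diagonals and of other lines.

  module _ (T : Aut) (p : Pt) (d : Axis → Dir) where

    main-image : Main d → Valid p d → ∃[ d′ ] (Main d′
      × (∀ t → ∃[ t′ ] to T (line p d t) ≡ line (to T p) d′ t′))
    main-image M v with d′ , nz′ , fw , bw ← to-lines T p d (X , M X) v =
      d′ , all-diagonal⇒main _ d′ nz′ diag , fw
      where
      diag : ∀ t → OnDiagonal (line (to T p) d′ t)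
      diag t′ with t , e ← bw t′ = subst OnDiagonal e (diagonal-map T (main⇒diagonal p d M t))

    -- The image is again a main diagonal, on which each single coordinate determines the point.
    main-image-apart : Main d → Valid p d → ∀ c t u →
      coord c (to T (line p d t)) ≡ coord c (to T (line p d u)) → line p d t ≡ line p d u
    main-image-apart M v c t u e
      with d′ , M′ , fw ← main-image M v
      with t′ , et ← fw t | u′ , eu ← fw u
      = to-inj T (trans et (trans (cong (line _ d′)
          (line-inj (to T p) d′ (proj₂ (M′ c)) (trans (cong (coord c) (sym et)) (trans e (cong (coord c) eu))))) (sym eu)))

    -- If the image were a main diagonal, the inverse would make every point of the original line
    -- diagonal. So the image line has a frozen coordinate.
    flat-image-shares : NonConst d → Valid p d → ∀ {c} → d c ≡ o → ∀ t →
      ∃[ c′ ] coord c′ (to T (line p d t)) ≡ coord c′ (to T p)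
    flat-image-shares nz v {c} e t
      with d′ , nz′ , fw , bw ← to-lines T p d nz v
      with main-or-flat d′
    ... | inj₂ (c′ , e′) = c′ , trans (cong (coord c′) (proj₂ (fw t))) (coord-flat _ d′ e′ _)
    ... | inj₁ M = ⊥-elim (mv≢o (trans (sym (proj₂ (M₀ c))) e))
      where
      diag : ∀ t → OnDiagonal (line p d t)
      diag t = subst OnDiagonal (trans (cong (from T) (sym (proj₂ (fw t)))) (from-to T _))
                 (diagonal-map (T ⁻¹) (main⇒diagonal (to T p) d′ M (proj₁ (fw t))))
      M₀ : Main d
      M₀ = all-diagonal⇒main p d nz diag

    -- A moving coordinate separates the points of the image line, so a repeated value means that
    -- the coordinate is frozen.
    image-coord-const : NonConst d → Valid p d → ∀ c {t u} → line p d t ≢ line p d u →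
      coord c (to T (line p d t)) ≡ coord c (to T (line p d u)) →
      ∀ w → coord c (to T (line p d w)) ≡ coord c (to T (line p d t))
    image-coord-const nz v c {t} {u} ne e w
      with d′ , nz′ , fw , bw ← to-lines T p d nz v
      with d′ c in ec
    ... | o    = trans (cong (coord c) (proj₂ (fw w))) (trans (coord-flat _ d′ ec _)
                 (sym (trans (cong (coord c) (proj₂ (fw t))) (coord-flat _ d′ ec _))))
    ... | mv s = contradiction (to-inj T (trans (proj₂ (fw t)) (trans (cong (line _ d′) t≡u) (sym (proj₂ (fw u)))))) ne
      where
      t≡u : proj₁ (fw t) ≡ proj₁ (fw u)
      t≡u = line-inj (to T p) d′ ec (trans (cong (coord c) (sym (proj₂ (fw t)))) (trans e (cong (coord c) (proj₂ (fw u)))))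

  -- Invariance of the cubes and of antipodes.

  -- The direction of a coordinate with sign `b` at parameter `a` and sign `b′` at parameter
  -- `opposite a`; `between` joins two points of a cube this way.
  step : Bool → Bool → Dir
  step true  true  = o
  step true  false = mv true
  step false true  = mv false
  step false false = o

  step-start : ∀ b b′ a → ap (step b b′) (sg b a) a ≡ sg b a
  step-start true  true  a = refl
  step-start true  false a = refl
  step-start false true  a = refl
  step-start false false a = refl

  step-end : ∀ b b′ a → ap (step b b′) (sg b a) (opposite a) ≡ sg b′ a
  step-end true  true  a = refl
  step-end true  false a = refl
  step-end false true  a = opposite-involutive a
  step-end false false a = refl

  step-same : ∀ {b b′} → b ≡ b′ → step b b′ ≡ o
  step-same {true}  refl = refl
  step-same {false} refl = refl

  step-not : ∀ b → step b (not b) ≡ mv b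
  step-not true  = refl
  step-not false = refl

  step-o : ∀ b b′ → step b b′ ≡ o → b ≡ b′
  step-o true  true  e = refl
  step-o false false e = refl

  module _ (a : Fin n) (b b′ : Axis → Bool) where

    between : Axis → Dir
    between c = step (b c) (b′ c)

    between-start : line (cu a b) between a ≡ cu a b
    between-start = pt-ext λ c → trans (coord-line _ between a c)
      (trans (cong (λ r → ap (between c) r a) (coord-cu a b c)) (trans (step-start (b c) (b′ c) a) (sym (coord-cu a b c))))

    between-end : line (cu a b) between (opposite a) ≡ cu a b′
    between-end = pt-ext λ c → trans (coord-line _ between _ c)
      (trans (cong (λ r → ap (between c) r (opposite a)) (coord-cu a b c)) (trans (step-end (b c) (b′ c) a) (sym (coord-cu a b′ c))))

  -- The two points coincide or are joined by a line frozen at `c`, whose image has a frozen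
  -- coordinate too.
  cube-share : ∀ T a b b′ c → b c ≡ b′ c → ∃[ c′ ] coord c′ (to T (cu a b′)) ≡ coord c′ (to T (cu a b))
  cube-share T a b b′ c e with nonConst-or-const (between a b b′)
  ... | inj₂ const = X , cong (λ q → coord X (to T q))
    (cu-cong a b′ a b λ c → cong (λ s → sg s a) (sym (step-o (b c) (b′ c) (const c))))
  ... | inj₁ nz with c′ , e′ ← flat-image-shares T (cu a b) (between a b b′) nz (a , between-start a b b′) (step-same e) (opposite a)
    = c′ , trans (cong (λ q → coord c′ (to T q)) (sym (between-end a b b′))) e′

  cube-step : ∀ T a b a′ → OnCube a′ (to T (cu a b)) → ∀ b′ c → b c ≡ b′ c → OnCube a′ (to T (cu a b′))
  cube-step T a b a′ (b₁ , e) b′ c ec with c′ , e′ ← cube-share T a b b′ c ec =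
    diagonal-at {to T (cu a b′)} {a′} (diagonal-map T (a , b′ , refl)) c′
      (b₁ c′ , trans e′ (trans (cong (coord c′) e) (coord-cu a′ b₁ c′)))

  abstract
    -- Two steps suffice: `b₀` agrees with `b` at `X` and with `b′` at `Y`. In each step the two
    -- images are diagonal and share a coordinate, hence a cube.
    cube-map : ∀ T a b a′ → OnCube a′ (to T (cu a b)) → ∀ b′ → OnCube a′ (to T (cu a b′))
    cube-map T a b a′ on b′ = cube-step T a b₀ a′ (cube-step T a b a′ on b₀ X refl) b′ Y refl
      where
      b₀ : Axis → Bool
      b₀ = axes (b X) (b′ Y) (b′ Z)

  -- Antipodes are joined by a main diagonal. Their images lie in one cube and on one main diagonal,
  -- so they differ in every sign.
  antipode-map : ∀ T a b a′ b₁ → a ≢ opposite a → to T (cu a b) ≡ cu a′ b₁ →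
    to T (cu a (not ∘ b)) ≡ cu a′ (not ∘ b₁)
  antipode-map T a b a′ b₁ ne e with b₂ , e₂ ← cube-map T a b a′ (b₁ , e) (not ∘ b) =
    trans e₂ (cu-cong a′ b₂ a′ (not ∘ b₁) λ c → cong (λ s → sg s a′) (¬-not (λ eq → apart c (same c eq))))
    where
    d : Axis → Dir
    d = between a b (not ∘ b)
    apart : ∀ c → coord c (to T (cu a b)) ≢ coord c (to T (cu a (not ∘ b)))
    apart c eq = not-¬ {b X} refl (sg-inj-sign ne (b X) (not (b X)) (cong xc
      (trans (sym (between-start a b (not ∘ b))) (trans ends (between-end a b (not ∘ b))))))
      where
      ends : line (cu a b) d a ≡ line (cu a b) d (opposite a)
      ends = main-image-apart T (cu a b) d (λ c → b c , step-not (b c)) (a , between-start a b (not ∘ b)) c a (opposite a)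
        (trans (cong (λ q → coord c (to T q)) (between-start a b (not ∘ b)))
          (trans eq (cong (λ q → coord c (to T q)) (sym (between-end a b (not ∘ b))))))
    same : ∀ c → b₂ c ≡ b₁ c → coord c (to T (cu a b)) ≡ coord c (to T (cu a (not ∘ b)))
    same c eq = trans (cong (coord c) e) (trans (coord-cu a′ b₁ c)
      (trans (cong (λ s → sg s a′) (sym eq)) (trans (sym (coord-cu a′ b₂ c)) (cong (coord c) (sym e₂)))))

  -- Edges against face diagonals.

  -- At an interior point of an edge the first coordinate is unrelated to the others, so it moves
  -- alone or is frozen.
  edge-neighbour : ∀ T p d → NonConst d → Valid p d → ∀ {j} → to T p ≡ (j , O , O) → ¬ (j ∼ O) → ∀ t →
    xc (to T (line p d t)) ≡ j ⊎ (yc (to T (line p d t)) ≡ O × zc (to T (line p d t)) ≡ O)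
  edge-neighbour T p d nz v {j} e j≁O t
    with d′ , _ , fw , _ ← to-lines T p d nz v = go (d′ X) (d′ Y) (d′ Z) refl refl refl
    where
    related : ∀ c c′ {s s′} → d′ c ≡ mv s → d′ c′ ≡ mv s′ → coord c (j , O , O) ∼ coord c′ (j , O , O)
    related c c′ ec ec′ = subst (λ q → coord c q ∼ coord c′ q) e
      (valid-∼ (to T p) d′ (valid-image (to T) p d d′ v fw) c c′ ec ec′)
    frozen : ∀ c → d′ c ≡ o → coord c (to T (line p d t)) ≡ coord c (j , O , O)
    frozen c ec = trans (cong (coord c) (proj₂ (fw t))) (trans (coord-flat (to T p) d′ ec _) (cong (coord c) e))
    go : ∀ k l h → d′ X ≡ k → d′ Y ≡ l → d′ Z ≡ h →
      xc (to T (line p d t)) ≡ j ⊎ (yc (to T (line p d t)) ≡ O × zc (to T (line p d t)) ≡ O)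
    go o      _      _      ex ey ez = inj₁ (frozen X ex)
    go (mv _) (mv _) _      ex ey ez = contradiction (related X Y ex ey) j≁O
    go (mv _) o      (mv _) ex ey ez = contradiction (related X Z ex ez) j≁O
    go (mv _) o      o      ex ey ez = inj₂ (frozen Y ey , frozen Z ez)

  abstract
    corner-map : ∀ T → to T (O , O , O) ≡ (O , O , O) → ∀ {p} → OnCube O p → OnCube O (to T p)
    corner-map T e₀ {p} (b , e) = subst (λ q → OnCube O (to T q)) (sym e)
      (cube-map T O (λ _ → true) O ((λ _ → true) , e₀) b)

  fixed-inverse : ∀ T {p} → to T p ≡ p → from T p ≡ p
  fixed-inverse T e = trans (cong (from T) (sym e)) (from-to T _)

  corner-reflect : ∀ T → to T (O , O , O) ≡ (O , O , O) → ∀ {p} → OnCube O (to T p) → OnCube O p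
  corner-reflect T e₀ on = subst (OnCube O) (from-to T _) (corner-map (T ⁻¹) (fixed-inverse T e₀) on)

  -- The point p = (1, 1, 0) of a face diagonal is joined by lines to two points q₁, q₂ of the other
  -- diagonal of its face (q₁ = q₂ = p if n = 3); an interior point of an edge is joined to at most
  -- one non-corner point of any other line through two corners, and lies on no such line.
  diagonal-not-to-edge : ∀ T → to T (O , O , O) ≡ (O , O , O) → to T (N , N , O) ≢ (N , O , O)
  diagonal-not-to-edge T e₀ e₁ = conclude d′-fw
    where
    dD dA : Axis → Dir
    dD = axes (mv true) (mv true) o
    dA = axes (mv true) (mv false) o
    p a q₁ q₂ : Pt
    p = one , one , O
    a = N , O , O
    q₁ = line a dA (opposite one)
    q₂ = line a dA one
    distinct : (O , O , O) ≢ (N , N , O)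
    distinct e = O≢N (cong xc e)
    j : Fin n
    j = xc (to T p)
    onEdge : to T p ≡ (j , O , O)
    onEdge = pt-ext λ
      { X → refl
      ; Y → trans (image-coord-const T (O , O , O) dD (X , true , refl) (O , refl) Y {O} {N} distinct
                    (trans (cong yc e₀) (sym (cong yc e₁))) one) (cong yc e₀)
      ; Z → trans (image-coord-const T (O , O , O) dD (X , true , refl) (O , refl) Z {O} {N} distinct
                    (trans (cong zc e₀) (sym (cong zc e₁))) one) (cong zc e₀) }
    not-corner : ∀ {q} → xc q ∼ one → ¬ OnCube O (to T q)
    not-corner r on = one≁O (∼-trans (∼-sym r) (cube⇒coord-∼ (corner-reflect T e₀ on) X))
    j≁O : ¬ (j ∼ O)
    j≁O r = not-corner {p} (true , refl) (subst (OnCube O) (sym onEdge)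
      (coords-∼⇒cube {j , O , O} λ { X → r ; Y → true , refl ; Z → true , refl }))
    Ta : OnCube O (to T a)
    Ta = corner-map T e₀ (axes false true true , refl)
    valid-a : Valid a dA
    valid-a = N , pt-ext λ { X → refl ; Y → opposite-involutive O ; Z → refl }
    d′-fw : ∃[ d′ ] (∀ t → ∃[ t′ ] to T (line a dA t) ≡ line (to T a) d′ t′)
    d′-fw with d′ , _ , fw , _ ← to-lines T a dA (X , true , refl) valid-a = d′ , fw
    Ta-not-on-edge : ¬ (yc (to T a) ≡ O × zc (to T a) ≡ O)
    Ta-not-on-edge (ey , ez) with cube⇒coord-∼ Ta X
    ... | true  , ex = O≢N (sym (cong xc (to-inj T {a} {O , O , O}
      (trans (pt-ext λ { X → ex ; Y → ey ; Z → ez }) (sym e₀)))))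
    ... | false , ex = O≢N (cong yc (to-inj T {a} {N , N , O}
      (trans (pt-ext λ { X → ex ; Y → ey ; Z → ez }) (sym e₁))))
    neighbour₁ : xc (to T q₁) ≡ j ⊎ (yc (to T q₁) ≡ O × zc (to T q₁) ≡ O)
    neighbour₁ = subst (λ y → let w = to T (opposite one , y , O) in xc w ≡ j ⊎ (yc w ≡ O × zc w ≡ O))
      (sym (opposite-involutive one))
      (edge-neighbour T p (axes (mv true) o o) (X , true , refl) (one , refl) onEdge j≁O (opposite one))
    neighbour₂ : xc (to T q₂) ≡ j ⊎ (yc (to T q₂) ≡ O × zc (to T q₂) ≡ O)
    neighbour₂ = edge-neighbour T p (axes o (mv true) o) (Y , true , refl) (one , refl) onEdge j≁O (opposite one)
    conclude : ∃[ d′ ] (∀ t → ∃[ t′ ] to T (line a dA t) ≡ line (to T a) d′ t′) → ⊥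
    conclude (d′ , fw) = cases neighbour₁ neighbour₂
      where
      corner-if-extreme : ∀ {t} → proj₁ (fw t) ∼ O → OnCube O (to T (line a dA t))
      corner-if-extreme {t} r = coords-∼⇒cube {to T (line a dA t)} λ c →
        subst (_∼ O) (sym (trans (cong (coord c) (proj₂ (fw t))) (coord-line (to T a) d′ _ c))) (extreme c (d′ c))
        where
        extreme : ∀ c k → ap k (coord c (to T a)) (proj₁ (fw t)) ∼ O
        extreme c o      = cube⇒coord-∼ Ta c
        extreme c (mv s) = ∼-trans (s , refl) r
      -- A moving coordinate is `O` only at an extreme parameter; there every coordinate is extreme,
      -- since `to T a` is a corner.
      frozen : ∀ t → ¬ OnCube O (to T (line a dA t)) → ∀ c → coord c (to T (line a dA t)) ≡ O → coord c (to T a) ≡ O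
      frozen t ¬corner c e with d′ c in ec
      ... | o    = trans (sym (trans (cong (coord c) (proj₂ (fw t))) (coord-flat (to T a) d′ ec _))) e
      ... | mv s = contradiction (corner-if-extreme {t} (s , sg-flip s
                     (trans (sym (coord-mv (to T a) d′ ec _)) (trans (cong (coord c) (sym (proj₂ (fw t)))) e)))) ¬corner
      on-edge : ∀ t → xc (line a dA t) ∼ one → ¬ (yc (to T (line a dA t)) ≡ O × zc (to T (line a dA t)) ≡ O)
      on-edge t r (ey , ez) = Ta-not-on-edge
        (frozen t (not-corner r) Y ey , frozen t (not-corner r) Z ez)
      cases : xc (to T q₁) ≡ j ⊎ (yc (to T q₁) ≡ O × zc (to T q₁) ≡ O) →
              xc (to T q₂) ≡ j ⊎ (yc (to T q₂) ≡ O × zc (to T q₂) ≡ O) → ⊥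
      cases (inj₂ on) _         = on-edge (opposite one) (false , refl) on
      cases (inj₁ _)  (inj₂ on) = on-edge one (true , refl) on
      -- If the first coordinate is frozen on the image line, the corner `to T a` has the
      -- non-extreme value `j`. If it moves, `q₁` and `q₂` coincide, hence equal `p`, whose image is
      -- on the edge.
      cases (inj₁ e)  (inj₁ e′) = both (d′ X) refl
        where
        both : ∀ k → d′ X ≡ k → ⊥
        both o      ex = j≁O (subst (_∼ O) (trans (sym (coord-flat (to T a) d′ ex _))
                     (trans (cong xc (sym (proj₂ (fw one)))) e′)) (cube⇒coord-∼ Ta X))
        both (mv s) ex = on-edge one (true , refl) (cong yc Tq₂≡Tp , cong zc Tq₂≡Tp)
          where
          q₁≡q₂ : q₁ ≡ q₂
          q₁≡q₂ = to-inj T (trans (proj₂ (fw _)) (trans (cong (line (to T a) d′)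
            (line-inj (to T a) d′ ex (trans (cong xc (sym (proj₂ (fw (opposite one)))))
              (trans e (trans (sym e′) (cong xc (proj₂ (fw one)))))))) (sym (proj₂ (fw _)))))
          Tq₂≡Tp : to T q₂ ≡ (j , O , O)
          Tq₂≡Tp = trans (cong (λ y → to T (one , y , O)) (cong xc q₁≡q₂)) onEdge

  -- Reflections and axis permutations as products of generators.

  Generated : (Pt → Pt) → Set
  Generated f = ∃[ g ] (InA g × g ≗ f)

  gen-∘ : ∀ {f g} → Generated f → Generated g → Generated (g ∘ f)
  gen-∘ {f} {g} (f′ , If , ef) (g′ , Ig , eg) = _ , If ∙ Ig , λ p → trans (eg (f′ p)) (cong g (ef p))

  opposite↔ : Fin n ↔ Fin n
  opposite↔ = mk↔ₛ′ opposite opposite opposite-involutive opposite-involutive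

  negX negY negZ : Bool → Pt → Pt
  negX s (x , y , z) = sg s x , y , z
  negY s (x , y , z) = x , sg s y , z
  negZ s (x , y , z) = x , y , sg s z

  -- A half turn negates two coordinates; composing with the central symmetry leaves one.
  gen-negX : ∀ s → Generated (negX s)
  gen-negX true  = _ , idA , λ _ → refl
  gen-negX false = _ , (rx ∙ rx) ∙ fπ opposite↔ (λ _ → refl) , λ p →
    pt-ext λ { X → refl ; Y → opposite-involutive _ ; Z → opposite-involutive _ }

  gen-negY : ∀ s → Generated (negY s)
  gen-negY true  = _ , idA , λ _ → refl
  gen-negY false = _ , (ry ∙ ry) ∙ fπ opposite↔ (λ _ → refl) , λ p →
    pt-ext λ { X → opposite-involutive _ ; Y → refl ; Z → opposite-involutive _ }

  gen-negZ : ∀ s → Generated (negZ s)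
  gen-negZ true  = _ , idA , λ _ → refl
  gen-negZ false = _ , (rz ∙ rz) ∙ fπ opposite↔ (λ _ → refl) , λ p →
    pt-ext λ { X → opposite-involutive _ ; Y → opposite-involutive _ ; Z → refl }

  gen-reflect : ∀ b → Generated (to (reflect b))
  gen-reflect b = gen-∘ (gen-∘ (gen-negX (b X)) (gen-negY (b Y))) (gen-negZ (b Z))

  -- A quarter turn followed by the negation of one coordinate transposes two axes.
  gen-swapXY : Generated (to swapXY)
  gen-swapXY with g , Ig , e ← gen-∘ (Rz , rz , λ _ → refl) (gen-negX false) =
    g , Ig , λ p → trans (e p) (pt-ext λ { X → opposite-involutive _ ; Y → refl ; Z → refl })

  gen-swapYZ : Generated (to swapYZ)
  gen-swapYZ with g , Ig , e ← gen-∘ (Rx , rx , λ _ → refl) (gen-negY false) =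
    g , Ig , λ p → trans (e p) (pt-ext λ { X → refl ; Y → opposite-involutive _ ; Z → refl })

  Goal : Aut → Set
  Goal T = ∃[ A ] (InA A × (∀ b → A (to T (cu O b)) ≡ cu O b) × (∀ t → A (to T (t , O , O)) ≡ (t , O , O)))

  -- Normalisation step: an automorphism may be followed by any generated map, which is then
  -- absorbed into the element sought.
  reduce : ∀ T S → Generated (to S) → Goal (T ⨟ S) → Goal T
  reduce T S (g , Ig , e) (A , IA , fixC , fixE) =
    _ , Ig ∙ IA , (λ b → trans (cong A (e _)) (fixC b)) , λ t → trans (cong A (e _)) (fixE t)

  -- The reversal has at most one fixed point. The preimage `u` of `opposite (f t)` must be fixed by
  -- it, hence equals the centre `t`, and so `f t` is fixed as well.
  symmetric-off-centre⇒symmetric : ∀ (f g : Fin n → Fin n) → (∀ t → f (g t) ≡ t) → (∀ t → g (f t) ≡ t) →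
    (∀ t → t ≢ opposite t → f (opposite t) ≡ opposite (f t)) → ∀ t → f (opposite t) ≡ opposite (f t)
  symmetric-off-centre⇒symmetric f g fg gf off t with t ≟ opposite t
  ... | no ne  = off t ne
  ... | yes et = trans (cong f (sym et)) (sym (trans (sym (fg _)) (cong f u≡t)))
    where
    u : Fin n
    u = g (opposite (f t))
    u-fixed : u ≡ opposite u
    u-fixed with u ≟ opposite u
    ... | yes e = e
    ... | no ne = trans (trans (sym (opposite-involutive u)) (trans (cong opposite ou≡t) (sym et))) (sym ou≡t)
      where
      ou≡t : opposite u ≡ t
      ou≡t = trans (sym (gf _)) (trans (cong g (trans (off u ne)
        (trans (cong opposite (fg _)) (opposite-involutive (f t))))) (gf t))
    u≡t : u ≡ t
    u≡t = opposite-fixed-unique (sym u-fixed) (sym et)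

  -- The action on an edge when all corners are fixed.

  FixesCorners : Aut → Set
  FixesCorners T = ∀ b → to T (cu O b) ≡ cu O b

  module Edge (T : Aut) (fix : FixesCorners T) where

    τ : Fin n → Fin n
    τ t = xc (to T (t , O , O))

    e₀ : to T (O , O , O) ≡ (O , O , O)
    e₀ = fix (λ _ → true)

    -- The two fixed ends agree in `Y` and in `Z`, so both coordinates are frozen on the image.
    edge-image : ∀ t → to T (t , O , O) ≡ (τ t , O , O)
    edge-image t = pt-ext λ { X → refl ; Y → frozen Y refl ; Z → frozen Z refl }
      where
      d : Axis → Dir
      d = axes (mv true) o o
      frozen : ∀ c → coord c (O , O , O) ≡ coord c (N , O , O) → coord c (to T (t , O , O)) ≡ coord c (O , O , O)
      frozen c e = trans (image-coord-const T (O , O , O) d (X , true , refl) (O , refl) c {O} {N} (λ e → O≢N (cong xc e))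
        (trans (cong (coord c) e₀) (trans e (sym (cong (coord c) (fix (axes false true true)))))) t) (cong (coord c) e₀)

    τ-extreme : ∀ s → τ (sg s O) ≡ sg s O
    τ-extreme s = cong xc (fix (axes s true true))

    τ-inj : ∀ {t u} → τ t ≡ τ u → t ≡ u
    τ-inj {t} {u} e = cong xc (to-inj T (trans (edge-image t) (trans (cong (_, (O , O)) e) (sym (edge-image u)))))

    τ-interior : ∀ {t} → ¬ (t ∼ O) → ¬ (τ t ∼ O)
    τ-interior t≁O (s , e) = t≁O (s , τ-inj (trans e (sym (τ-extreme s))))

    -- (t, t, t) and (t, 0, 0) lie on a line with `X` frozen. Its image either keeps the first
    -- coordinate or stays on the edge; a diagonal point on the edge is a corner, which only corners
    -- reach.
    diagonal-image : ∀ {t} → ¬ (t ∼ O) → OnCube (τ t) (to T (t , t , t))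
    diagonal-image {t} t≁O
      with edge-neighbour T (t , O , O) (axes o (mv true) (mv true)) (Y , true , refl) (O , refl) (edge-image t) (τ-interior t≁O) t
    ... | inj₁ ex       = diagonal-at (diagonal-map T (t , (λ _ → true) , refl)) X (true , ex)
    ... | inj₂ (ey , _) = contradiction (cube⇒coord-∼ (corner-reflect T e₀
            (diagonal-at (diagonal-map T (t , (λ _ → true) , refl)) Y (true , ey))) X) t≁O

    -- (t, t, t) and its antipode lie in one cube of eight diagonal points, hence so do their images.
    τ-opposite-∼ : ∀ {t} → ¬ (t ∼ O) → τ (opposite t) ∼ τ t
    τ-opposite-∼ {t} t≁O = ∼-trans {u = xc (to T (cu t (λ _ → false)))}
      (∼-sym (cube⇒coord-∼ {a = τ (opposite t)} (diagonal-image (t≁O ∘ sg-∼ false)) X))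
      (cube⇒coord-∼ {a = τ t} (cube-map T t (λ _ → true) (τ t) (diagonal-image t≁O) (λ _ → false)) X)

    τ-symmetric-off-centre : ∀ t → t ≢ opposite t → τ (opposite t) ≡ opposite (τ t)
    τ-symmetric-off-centre t ne with t ∼? O
    ... | yes (s , refl) = trans (cong τ (sym (sg-not s O))) (trans (τ-extreme (not s))
            (trans (sg-not s O) (cong opposite (sym (τ-extreme s)))))
    ... | no t≁O = go (τ-opposite-∼ t≁O)
      where
      go : τ (opposite t) ∼ τ t → τ (opposite t) ≡ opposite (τ t)
      go (true  , e) = contradiction (sym (τ-inj e)) ne
      go (false , e) = e

  goal-corners-fixed : ∀ T → FixesCorners T → Goal T
  goal-corners-fixed T fix = Fπ π , fπ π π-symmetric , fixC , fixE
    where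
    module E = Edge T fix
    fix′ : FixesCorners (T ⁻¹)
    fix′ b = fixed-inverse T (fix b)
    -- The edge permutation of the inverse automorphism is inverse to that of `T`, and serves as
    -- `π`.
    module E′ = Edge (T ⁻¹) fix′
    ττ′ : ∀ t → E.τ (E′.τ t) ≡ t
    ττ′ t = cong xc (trans (cong (to T) (sym (E′.edge-image t))) (to-from T _))
    τ′τ : ∀ t → E′.τ (E.τ t) ≡ t
    τ′τ t = cong xc (trans (cong (from T) (sym (E.edge-image t))) (from-to T _))
    π : Fin n ↔ Fin n
    π = mk↔ₛ′ E′.τ E.τ τ′τ ττ′
    π-symmetric : SymmetricPerm π
    π-symmetric = symmetric-off-centre⇒symmetric E′.τ E.τ τ′τ ττ′ E′.τ-symmetric-off-centre
    fixC : ∀ b → Fπ π (to T (cu O b)) ≡ cu O b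
    fixC b = trans (cong (Fπ π) (fix b)) (pt-ext λ { X → E′.τ-extreme (b X) ; Y → E′.τ-extreme (b Y) ; Z → E′.τ-extreme (b Z) })
    fixE : ∀ t → Fπ π (to T (t , O , O)) ≡ (t , O , O)
    fixE t = trans (cong (Fπ π) (E.edge-image t)) (pt-ext λ { X → τ′τ t ; Y → E′.τ-extreme true ; Z → E′.τ-extreme true })

  -- The neighbours of the origin.

  eX eY eZ : Pt
  eX = N , O , O
  eY = O , N , O
  eZ = O , O , N

  antipode-fixed : ∀ T b → to T (cu O b) ≡ cu O b → to T (cu O (not ∘ b)) ≡ cu O (not ∘ b)
  antipode-fixed T b = antipode-map T O b O b O≢N

  goal-axes-fixed : ∀ T → to T (O , O , O) ≡ (O , O , O) → to T eX ≡ eX → to T eY ≡ eY → to T eZ ≡ eZ → Goal T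
  goal-axes-fixed T e₀ ex ey ez = goal-corners-fixed T λ b → fix (b X) (b Y) (b Z)
    where
    fix : ∀ s s′ s″ → to T (sg s O , sg s′ O , sg s″ O) ≡ (sg s O , sg s′ O , sg s″ O)
    fix true  true  true  = e₀
    fix false true  true  = ex
    fix true  false true  = ey
    fix true  true  false = ez
    fix true  false false = antipode-fixed T (axes false true true) ex
    fix false true  false = antipode-fixed T (axes true false true) ey
    fix false false true  = antipode-fixed T (axes true true false) ez
    fix false false false = antipode-fixed T (λ _ → true) e₀

  edge-not-to-diagonal : ∀ T → to T (O , O , O) ≡ (O , O , O) → to T eX ≢ (N , N , O)
  edge-not-to-diagonal T e₀ e = diagonal-not-to-edge (T ⁻¹) (fixed-inverse T e₀)
    (trans (cong (from T) (sym e)) (from-to T _))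

  AxisCorner : Pt → Set
  AxisCorner p = p ≡ eX ⊎ p ≡ eY ⊎ p ≡ eZ

  abstract
    -- Of the eight corners, the origin and its antipode are already images of themselves, and the
    -- three ends of face diagonals are excluded up to a permutation of axes.
    axis-image : ∀ T → to T (O , O , O) ≡ (O , O , O) → AxisCorner (to T eX)
    axis-image T e₀ with b , e ← corner-map T e₀ {eX} (axes false true true , refl) = go (b X) (b Y) (b Z) e
      where
      go : ∀ s s′ s″ → to T eX ≡ (sg s O , sg s′ O , sg s″ O) → AxisCorner (to T eX)
      go false true  true  e = inj₁ e
      go true  false true  e = inj₂ (inj₁ e)
      go true  true  false e = inj₂ (inj₂ e)
      go true  true  true  e = contradiction (cong xc (to-inj T (trans e (sym e₀)))) (O≢N ∘ sym)
      go false false false e = contradiction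
        (cong yc (to-inj T {eX} (trans e (sym (antipode-fixed T (λ _ → true) e₀))))) O≢N
      go false false true  e = contradiction e (edge-not-to-diagonal T e₀)
      go false true  false e = contradiction (cong (to swapYZ) e)
        (edge-not-to-diagonal (T ⨟ swapYZ) (cong (to swapYZ) e₀))
      go true  false false e = contradiction (cong (to (swapXY ⨟ swapYZ)) e)
        (edge-not-to-diagonal (T ⨟ (swapXY ⨟ swapYZ)) (cong (to (swapXY ⨟ swapYZ)) e₀))

  goal-two-axes-fixed : ∀ T → to T (O , O , O) ≡ (O , O , O) → to T eX ≡ eX → to T eY ≡ eY → Goal T
  -- Precomposing with the axis permutation carries `eX` to `eZ`, so this concerns the image of
  -- `eZ`.
  goal-two-axes-fixed T e₀ ex ey with axis-image ((swapXY ⨟ swapYZ) ⨟ T) e₀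
  ... | inj₁ e        = contradiction (cong xc (to-inj T (trans e (sym ex)))) O≢N
  ... | inj₂ (inj₁ e) = contradiction (cong yc (to-inj T (trans e (sym ey)))) O≢N
  ... | inj₂ (inj₂ e) = goal-axes-fixed T e₀ ex ey e

  goal-one-axis-fixed : ∀ T → to T (O , O , O) ≡ (O , O , O) → to T eX ≡ eX → Goal T
  goal-one-axis-fixed T e₀ ex with axis-image (swapXY ⨟ T) e₀
  ... | inj₁ e        = contradiction (cong xc (to-inj T (trans e (sym ex)))) O≢N
  ... | inj₂ (inj₁ e) = goal-two-axes-fixed T e₀ ex e
  ... | inj₂ (inj₂ e) = reduce T swapYZ gen-swapYZ
    (goal-two-axes-fixed (T ⨟ swapYZ) (cong (to swapYZ) e₀) (cong (to swapYZ) ex) (cong (to swapYZ) e))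

  goal-origin-fixed : ∀ T → to T (O , O , O) ≡ (O , O , O) → Goal T
  goal-origin-fixed T e₀ with axis-image T e₀
  ... | inj₁ e        = goal-one-axis-fixed T e₀ e
  ... | inj₂ (inj₁ e) = reduce T swapXY gen-swapXY
    (goal-one-axis-fixed (T ⨟ swapXY) (cong (to swapXY) e₀) (cong (to swapXY) e))
  ... | inj₂ (inj₂ e) = reduce T (swapYZ ⨟ swapXY) (gen-∘ gen-swapYZ gen-swapXY)
    (goal-one-axis-fixed (T ⨟ (swapYZ ⨟ swapXY)) (cong (to (swapYZ ⨟ swapXY)) e₀) (cong (to (swapYZ ⨟ swapXY)) e))

  -- Returning the image of the origin to the origin.

  -- All three coordinates vanish at one parameter, which forces equal signs.
  main-through-origin : ∀ d → Main d → Valid (O , O , O) d → ∀ t → ∃[ k ] line (O , O , O) d t ≡ (k , k , k)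
  main-through-origin d M (t₀ , v) t = sg (s X) t , pt-ext λ { X → at X ; Y → at Y ; Z → at Z }
    where
    s : Axis → Bool
    s c = proj₁ (M c)
    at-origin : ∀ c → sg (s c) t₀ ≡ coord c (O , O , O)
    at-origin c = trans (sym (coord-mv (O , O , O) d (proj₂ (M c)) t₀)) (cong (coord c) v)
    coord-O : ∀ c → coord c (O , O , O) ≡ O
    coord-O X = refl
    coord-O Y = refl
    coord-O Z = refl
    same : ∀ c → s c ≡ s X
    same c = sg-inj-sign O≢N (s c) (s X)
      (trans (sym (sg-flip (s c) (trans (at-origin c) (coord-O c)))) (sg-flip (s X) (at-origin X)))
    at : ∀ c → coord c (line (O , O , O) d t) ≡ sg (s X) t
    at c = trans (coord-mv (O , O , O) d (proj₂ (M c)) t) (cong (λ s → sg s t) (same c))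

  -- Several main diagonals pass through the centre, only one through a corner.
  origin-not-to-centre : ∀ T {a} → a ≡ opposite a → to T (O , O , O) ≢ (a , a , a)
  origin-not-to-centre T {a} ea e = apart (preimage (axes (mv true) (mv true) (mv true)) all-mv (a , refl) O)
      (preimage (axes (mv true) (mv true) (mv false)) last-mv (a , cong (λ z → a , a , z) (sym ea)) O)
    where
    all-mv : Main (axes (mv true) (mv true) (mv true))
    all-mv X = true , refl
    all-mv Y = true , refl
    all-mv Z = true , refl
    last-mv : Main (axes (mv true) (mv true) (mv false))
    last-mv X = true , refl
    last-mv Y = true , refl
    last-mv Z = false , refl
    centre : from T (a , a , a) ≡ (O , O , O)
    centre = trans (cong (from T) (sym e)) (from-to T _)
    -- The inverse takes a main diagonal through the centre to one through the origin, that is, to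
    -- the points (k, k, k).
    preimage : ∀ d → Main d → Valid (a , a , a) d → ∀ t → ∃[ k ] to T (k , k , k) ≡ line (a , a , a) d t
    preimage d M v t
      with d′ , M′ , fw ← main-image (T ⁻¹) (a , a , a) d M v
      with k , ek ← main-through-origin d′ M′
             (subst (λ q → Valid q d′) centre (valid-image (from T) (a , a , a) d d′ v fw)) (proj₁ (fw t))
      = k , trans (cong (to T) (sym (trans (proj₂ (fw t)) (trans (cong (λ q → line q d′ (proj₁ (fw t))) centre) ek)))) (to-from T _)
    -- Two points with the same first coordinate cannot be distinct images from one main diagonal.
    apart : ∃[ k ] to T (k , k , k) ≡ (O , O , O) → ∃[ l ] to T (l , l , l) ≡ (O , O , N) → ⊥
    apart (k , ek) (l , el) = O≢N (cong zc (trans (sym ek) (trans (cong (to T) kkk≡lll) el)))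
      where
      kkk≡lll : (k , k , k) ≡ (l , l , l)
      kkk≡lll = main-image-apart T (O , O , O) (axes (mv true) (mv true) (mv true)) all-mv (O , refl) X k l
        (trans (cong xc ek) (sym (cong xc el)))

  module Exchange (a : Fin n) (a≁O : ¬ (a ∼ O)) (a≢ : a ≢ opposite a) where

    data View : Fin n → Set where
      at-O  : ∀ s → View (sg s O)
      at-a  : ∀ s → View (sg s a)
      other : ∀ {x} → ¬ (x ∼ O) → ¬ (x ∼ a) → View x

    view : ∀ x → View x
    view x with x ∼? O | x ∼? a
    ... | yes (s , refl) | _              = at-O s
    ... | no _           | yes (s , refl) = at-a s
    ... | no x≁O         | no x≁a         = other x≁O x≁a

    eval : ∀ {x} → View x → Fin n
    eval (at-O s)        = sg s a
    eval (at-a s)        = sg s O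
    eval (other {x} _ _) = x

    -- The exchange of `a` with `O` and of their negatives is independent of the chosen view: `a≢`
    -- determines the sign at `a`, and `a≁O` keeps the cases apart.
    eval-unique : ∀ {x y} (v : View x) (w : View y) → x ≡ y → eval v ≡ eval w
    eval-unique (at-O s)    (at-O s′)    e = cong (λ s → sg s a) (sg-inj-sign O≢N s s′ e)
    eval-unique (at-a s)    (at-a s′)    e = cong (λ s → sg s O) (sg-inj-sign a≢ s s′ e)
    eval-unique (other _ _) (other _ _)  e = e
    eval-unique (at-O s)    (at-a s′)    e = contradiction (sg-∼ s′ (s , sym e)) a≁O
    eval-unique (at-a s)    (at-O s′)    e = contradiction (sg-∼ s (s′ , e)) a≁O
    eval-unique (at-O s)    (other ≁O _) e = contradiction (s , sym e) ≁O
    eval-unique (at-a s)    (other _ ≁a) e = contradiction (s , sym e) ≁a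
    eval-unique (other ≁O _) (at-O s)    e = contradiction (s , e) ≁O
    eval-unique (other _ ≁a) (at-a s)    e = contradiction (s , e) ≁a

    swap : Fin n → Fin n
    swap x = eval (view x)

    swap-eval : ∀ {x} (v : View x) → swap x ≡ eval v
    swap-eval v = eval-unique (view _) v refl

    swap-involutive : ∀ x → swap (swap x) ≡ x
    swap-involutive x with view x
    ... | at-O s        = swap-eval (at-a s)
    ... | at-a s        = swap-eval (at-O s)
    ... | other ≁O ≁a   = swap-eval (other ≁O ≁a)

    swap-sg : ∀ s x → swap (sg s x) ≡ sg s (swap x)
    swap-sg s x with view x
    ... | at-O s′ = trans (cong swap (sym (sg-⊗ s s′ O))) (trans (swap-eval (at-O (s ⊗ s′))) (sg-⊗ s s′ a))
    ... | at-a s′ = trans (cong swap (sym (sg-⊗ s s′ a))) (trans (swap-eval (at-a (s ⊗ s′))) (sg-⊗ s s′ O))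
    ... | other ≁O ≁a = swap-eval (other (≁O ∘ sg-∼ s) (≁a ∘ sg-∼ s))

  symmetric-perm-to-O : ∀ a → a ≢ opposite a → ∃[ π ] (SymmetricPerm π × Inverse.to π a ≡ O)
  symmetric-perm-to-O a a≢ with a ∼? O
  ... | yes (true  , e) = id↔ , (λ _ → refl) , e
  ... | yes (false , e) = opposite↔ , (λ _ → refl) , trans (cong opposite e) (opposite-involutive O)
  ... | no a≁O = mk↔ₛ′ swap swap swap-involutive swap-involutive , swap-sg false , swap-eval (at-a true)
    where open Exchange a a≁O a≢

  goal : ∀ T → Goal T
  goal T with a , b , e ← diagonal-map T {O , O , O} (O , (λ _ → true) , refl) = main (a ≟ opposite a)
    where
    -- Reflecting by the signs of the image of the origin gives all three coordinates the same value
    -- `a`.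
    T₁ : Aut
    T₁ = T ⨟ reflect b
    e₁ : to T₁ (O , O , O) ≡ (a , a , a)
    e₁ = trans (cong (to (reflect b)) e) (pt-ext λ { X → sg-invol (b X) a ; Y → sg-invol (b Y) a ; Z → sg-invol (b Z) a })
    main : Dec (a ≡ opposite a) → Goal T
    main (yes ea) = contradiction e₁ (origin-not-to-centre T₁ ea)
    main (no a≢) with π , πsym , πa ← symmetric-perm-to-O a a≢ =
      reduce T (reflect b) (gen-reflect b) (reduce T₁ (relabel π πsym) (Fπ π , fπ π πsym , λ _ → refl)
        (goal-origin-fixed (T₁ ⨟ relabel π πsym) (trans (cong (Fπ π) e₁) (cong (λ k → k , k , k) πa))))

  -- Back to corners and the line given by numerical values.

  extreme⇒∼ : ∀ {c} → IsExtreme c → c ∼ O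
  extreme⇒∼ (inj₁ e) = true , toℕ-injective e
  extreme⇒∼ (inj₂ e) = false , toℕ-injective (trans e (sym (toℕ-fromℕ _)))

  corner⇒cube : ∀ {c} → IsCorner c → OnCube O c
  corner⇒cube {c} (ex , ey , ez) = coords-∼⇒cube {c} λ { X → extreme⇒∼ ex ; Y → extreme⇒∼ ey ; Z → extreme⇒∼ ez }

theorem3 : (n : ℕ) → 3 ≤ n → (T : Automorphism {n}) →
    ∃[ A ] (InA {n} A
    × (∀ c → IsCorner c → A (Inverse.to (Automorphism.perm T) c) ≡ c)
    × (∀ p → OnEll p → A (Inverse.to (Automorphism.perm T) p) ≡ p))
theorem3 (suc (suc (suc m))) (s≤s (s≤s (s≤s z≤n))) T
  with A , IA , fixC , fixE ← Cube.goal m (Cube.automorphism⇒aut m T) = A , IA , corners , edge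
  where
  open Cube m
  corners : ∀ c → IsCorner c → A (Inverse.to (Automorphism.perm T) c) ≡ c
  corners c k with b , refl ← corner⇒cube {c} k = fixC b
  edge : ∀ p → OnEll p → A (Inverse.to (Automorphism.perm T) p) ≡ p
  edge (t , y , z) (ey , ez) with refl ← toℕ-injective {j = O} ey | refl ← toℕ-injective {j = O} ez = fixE t
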